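{- Let $G$ be an abelian group (written multiplicatively, with identity $1$) and let $(A,B)$ be a pair of nonempty finite subsets of $G$ with $|A|=|B|$. Suppose $(A,B)$ is unmatchable, as witnessed by a decomposition into a disjoint union $$A = S \cup Y,$$ where $S$ is a disjoint union of cosets of the subgroup $\langle R\rangle$ for some nonempty $R\subseteq B$, and $|Y|<|R|$. Suppose $H$ is a subgroup of $G$ satisfying $H\cap (SS^{ -1}\cup RR^{ -1})=\{1\}$, and let $\pi : G\to G/H$ be the corresponding quotient map. Then the projected pair $(\pi(A),\pi(B))$ is unmatchable in $G/H$.
   Context: For nonempty finite subsets $A,B$ of an abelian group $G$, a matching from $A$ to $B$ is a bijection $f:A\to B$ such that $af(a)\notin A$ for all $a\in A$. The pair $(A,B)$ is matchable if at least one matching from $A$ to $B$ exists, and unmatchable otherwise; in particular, if $|A|\neq|B|$ then $(A,B)$ is unmatchable. For a subset $X\subseteq G$, $\langle X\rangle$ denotes the subgroup of $G$ generated by $X$, and $XX^{ -1}=\{xy^{ -1}: x,y\in X\}$. -}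

module Defs where

open import Algebra.Bundles using (AbelianGroup)
open import Algebra.Morphism.Structures using (IsGroupHomomorphism)
import Algebra.Properties.AbelianGroup as AbelianGroupProperties
import Algebra.Properties.CommutativeSemigroup as CommutativeSemigroupProperties
open import Data.Fin.Base using (Fin)
open import Data.Nat.Base using (ℕ)
open import Data.Product.Base using (∃-syntax; _×_; _,_; proj₁; proj₂)
open import Function.Base using (id)
open import Function.Bundles using (Bijection)
open import Level using (Level; _⊔_; suc)
open import Relation.Binary.Bundles using (Setoid)
import Relation.Binary.Construct.On as On
open import Relation.Binary.Definitions using (_Respects_)
open import Relation.Binary.PropositionalEquality using (_≢_)
import Relation.Binary.PropositionalEquality as ≡
open import Relation.Nullary.Negation.Core using (¬_)
open import Relation.Unary using (Pred; _∈_; _∉_; _≐_; _⊥_; ⋃)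

private
  variable
    c ℓ c′ ℓ′ p q k : Level

-- The elements of P, identified when equal in X; membership proofs are ignored.
elements : (X : Setoid c ℓ) → Pred (Setoid.Carrier X) p → Setoid (c ⊔ p) ℓ
elements X P = On.setoid X (proj₁ {B = P})

record FiniteSubset (X : Setoid c ℓ) (p : Level) : Set (c ⊔ ℓ ⊔ suc p) where
  open Setoid X
  field
    pred        : Pred Carrier p
    respects    : pred Respects _≈_
    ∣_∣         : ℕ
    enumeration : Bijection (≡.setoid (Fin ∣_∣)) (elements X pred)

open FiniteSubset public using (pred; ∣_∣)

image : (X : Setoid c ℓ) (X′ : Setoid c′ ℓ′) →
        (Setoid.Carrier X → Setoid.Carrier X′) →
        Pred (Setoid.Carrier X) p → Pred (Setoid.Carrier X′) (c ⊔ ℓ′ ⊔ p)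
image X X′ f P y = ∃[ x ] x ∈ P × f x ≈′ y
  where open Setoid X′ using () renaming (_≈_ to _≈′_)

module _ (G : AbelianGroup c ℓ) where
  open AbelianGroup G

  record Matching (A : Pred Carrier p) (B : Pred Carrier q) :
                  Set (c ⊔ ℓ ⊔ p ⊔ q) where
    field
      bijection : Bijection (elements setoid A) (elements setoid B)

    open Bijection bijection public using (to)

    field
      avoids : ∀ a → proj₁ a ∙ proj₁ (to a) ∉ A

  -- Matching is data, so Matchable is inhabited exactly when some matching
  -- exists.  If A and B have different sizes, no bijection exists and the pair
  -- is unmatchable.
  Matchable : Pred Carrier p → Pred Carrier q → Set (c ⊔ ℓ ⊔ p ⊔ q)
  Matchable A B = Matching A B

  Unmatchable : Pred Carrier p → Pred Carrier q → Set (c ⊔ ℓ ⊔ p ⊔ q)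
  Unmatchable A B = ¬ Matchable A B

  record Subgroup (p : Level) : Set (c ⊔ ℓ ⊔ suc p) where
    field
      member    : Pred Carrier p
      respects  : member Respects _≈_
      ε-closed  : ε ∈ member
      ∙-closed  : ∀ {x y} → x ∈ member → y ∈ member → x ∙ y ∈ member
      ⁻¹-closed : ∀ {x} → x ∈ member → x ⁻¹ ∈ member

  data Generated (X : Pred Carrier p) : Pred Carrier (c ⊔ ℓ ⊔ p) where
    gen  : ∀ {x} → x ∈ X → Generated X x
    unit : Generated X ε
    mul  : ∀ {x y} → Generated X x → Generated X y → Generated X (x ∙ y)
    inv  : ∀ {x} → Generated X x → Generated X (x ⁻¹)
    resp : ∀ {x y} → x ≈ y → Generated X x → Generated X y

  ⟨_⟩ : Pred Carrier p → Subgroup (c ⊔ ℓ ⊔ p)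
  ⟨ X ⟩ = record
    { member    = Generated X
    ; respects  = resp
    ; ε-closed  = unit
    ; ∙-closed  = mul
    ; ⁻¹-closed = inv
    }

  coset : Carrier → Subgroup p → Pred Carrier (c ⊔ ℓ ⊔ p)
  coset t K z = ∃[ x ] x ∈ Subgroup.member K × t ∙ x ≈ z

  record IsDisjointUnionOfCosets (S : Pred Carrier p) (K : Subgroup k)
                                 (i : Level) : Set (c ⊔ ℓ ⊔ p ⊔ k ⊔ suc i) where
    field
      Index          : Set i
      representative : Index → Carrier
      union          : S ≐ ⋃ Index (λ j → coset (representative j) K)
      disjoint       : ∀ {j j′} → j ≢ j′ →
                       coset (representative j) K ⊥ coset (representative j′) K

  -- X X⁻¹ = { x y⁻¹ : x , y ∈ X }
  quotients : Pred Carrier p → Pred Carrier (c ⊔ ℓ ⊔ p)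
  quotients X z = ∃[ x ] ∃[ y ] x ∈ X × y ∈ X × x ∙ y ⁻¹ ≈ z

  ｛1｝ : Pred Carrier ℓ
  ｛1｝ z = z ≈ ε

-- G / H has the carrier of G, with x and y identified when x y⁻¹ ∈ H.
module _ (G : AbelianGroup c ℓ) (H : Subgroup G p) where
  open AbelianGroup G
  open Subgroup H
  open AbelianGroupProperties G
  open CommutativeSemigroupProperties commutativeSemigroup using (interchange)
  open import Relation.Binary.Reasoning.Setoid setoid

  private
    _∼_ : Carrier → Carrier → Set p
    x ∼ y = x ∙ y ⁻¹ ∈ member

    ≈⇒∼ : ∀ {x y} → x ≈ y → x ∼ y
    ≈⇒∼ x≈y = respects (sym (x≈y⇒x∙y⁻¹≈ε x≈y)) ε-closed

    ∼-sym : ∀ {x y} → x ∼ y → y ∼ x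
    ∼-sym {x} {y} x∼y = respects (⁻¹-anti-homo‿- x y) (⁻¹-closed x∼y)

    ∼-trans : ∀ {x y z} → x ∼ y → y ∼ z → x ∼ z
    ∼-trans {x} {y} {z} x∼y y∼z = respects eq (∙-closed x∼y y∼z)
      where
      eq : (x ∙ y ⁻¹) ∙ (y ∙ z ⁻¹) ≈ x ∙ z ⁻¹
      eq = begin
        (x ∙ y ⁻¹) ∙ (y ∙ z ⁻¹)  ≈⟨ assoc _ _ _ ⟨
        ((x ∙ y ⁻¹) ∙ y) ∙ z ⁻¹  ≈⟨ ∙-congʳ (//-rightDividesˡ y x) ⟩
        x ∙ z ⁻¹                 ∎

    ∼-∙-cong : ∀ {x y u v} → x ∼ y → u ∼ v → (x ∙ u) ∼ (y ∙ v)
    ∼-∙-cong {x} {y} {u} {v} x∼y u∼v = respects eq (∙-closed x∼y u∼v)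
      where
      eq : (x ∙ y ⁻¹) ∙ (u ∙ v ⁻¹) ≈ (x ∙ u) ∙ (y ∙ v) ⁻¹
      eq = begin
        (x ∙ y ⁻¹) ∙ (u ∙ v ⁻¹)  ≈⟨ interchange _ _ _ _ ⟩
        (x ∙ u) ∙ (y ⁻¹ ∙ v ⁻¹)  ≈⟨ ∙-congˡ (⁻¹-∙-comm y v) ⟩
        (x ∙ u) ∙ (y ∙ v) ⁻¹     ∎

    ∼-⁻¹-cong : ∀ {x y} → x ∼ y → (x ⁻¹) ∼ (y ⁻¹)
    ∼-⁻¹-cong {x} {y} x∼y = respects (sym (⁻¹-∙-comm x (y ⁻¹))) (⁻¹-closed x∼y)

  quotientGroup : AbelianGroup c p
  quotientGroup = record
    { Carrier = Carrier
    ; _≈_     = _∼_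
    ; _∙_     = _∙_
    ; ε       = ε
    ; _⁻¹     = _⁻¹
    ; isAbelianGroup = record
      { isGroup = record
        { isMonoid = record
          { isSemigroup = record
            { isMagma = record
              { isEquivalence = record
                { refl = ≈⇒∼ refl ; sym = ∼-sym ; trans = ∼-trans }
              ; ∙-cong = ∼-∙-cong
              }
            ; assoc = λ x y z → ≈⇒∼ (assoc x y z)
            }
          ; identity = (λ x → ≈⇒∼ (identityˡ x)) , (λ x → ≈⇒∼ (identityʳ x))
          }
        ; inverse = (λ x → ≈⇒∼ (inverseˡ x)) , (λ x → ≈⇒∼ (inverseʳ x))
        ; ⁻¹-cong = ∼-⁻¹-cong
        }
      ; comm = λ x y → ≈⇒∼ (comm x y)
      }
    }

  quotientMap : Carrier → AbelianGroup.Carrier quotientGroup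
  quotientMap = id

  quotientMap-isGroupHomomorphism :
    IsGroupHomomorphism rawGroup (AbelianGroup.rawGroup quotientGroup) quotientMap
  quotientMap-isGroupHomomorphism = record
    { isMonoidHomomorphism = record
      { isMagmaHomomorphism = record
        { isRelHomomorphism = record { cong = ≈⇒∼ }
        ; homo = λ _ _ → ≈⇒∼ refl
        }
      ; ε-homo = ≈⇒∼ refl
      }
    ; ⁻¹-homo = λ _ → ≈⇒∼ refl
    }

  project : Pred Carrier k → Pred (AbelianGroup.Carrier quotientGroup) (c ⊔ p ⊔ k)
  project = image setoid (AbelianGroup.setoid quotientGroup) quotientMap

-- A matching of (π(A), π(B)) pairs each r ∈ R, viewed in π(B), with some x ∈ A.
-- Were x in S, then x r would lie in S ⊆ A, as S is a union of ⟨R⟩-cosets;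
-- hence x ∈ Y.  As π is injective on R, the map r ↦ x is an injection R → Y,
-- contradicting |Y| < |R|.
module Submission where

open import Defs
open import Algebra.Bundles using (AbelianGroup)
open import Algebra.Morphism.Structures using (module IsGroupHomomorphism)
import Algebra.Properties.AbelianGroup as AbelianGroupProperties
open import Data.Empty using (⊥-elim)
open import Data.Fin.Properties using (injective⇒≤)
open import Data.Nat.Base using (_<_; _≤_)
open import Data.Nat.Properties using (<⇒≱)
open import Data.Product.Base using (_×_; _,_; proj₁; proj₂; ∃-syntax)
open import Data.Sum.Base using (inj₁; inj₂)
open import Function.Bundles using (Bijection)
open import Function.Definitions using (Injective)
open import Level using (Level)
open import Relation.Binary.Bundles using (Setoid)
open import Relation.Binary.PropositionalEquality using (_≡_)
open import Relation.Unary using (Pred; Satisfiable; _∈_; _⊆_; _∪_; _∩_; _≐_; _⊥_)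

private
  variable
    c ℓ c′ ℓ′ p q s k i : Level

-- Sending `j` to the `Q`-index of `f (P.to j)` gives an injection between the `Fin` types. `f` may
-- take different values on equal elements: only its values at the enumerated points enter.
injection⇒∣∣≤∣∣ :
  {X : Setoid c ℓ} {X′ : Setoid c′ ℓ′} (P : FiniteSubset X p) (Q : FiniteSubset X′ q) →
  let module EP = Setoid (elements X (pred P)); module EQ = Setoid (elements X′ (pred Q)) in
  (f : EP.Carrier → EQ.Carrier) → Injective EP._≈_ EQ._≈_ f →
  ∣ P ∣ ≤ ∣ Q ∣
injection⇒∣∣≤∣∣ {X′ = X′} P Q f f-injective =
  injective⇒≤ {f = λ j → proj₁ (index (f (P.to j)))} λ {j} {j′} eq →
    P.injective (f-injective (trans (sym (proj₂ (index (f (P.to j)))))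
      (trans (Q.cong eq) (proj₂ (index (f (P.to j′)))))))
  where
  open Setoid X′
  module P = Bijection (FiniteSubset.enumeration P)
  module Q = Bijection (FiniteSubset.enumeration Q)
  index = Q.strictlySurjective

module _ (G : AbelianGroup c ℓ) where
  open AbelianGroup G

  -- If `x ≈ t ∙ u` with `u` in `K`, then `x ∙ z ≈ t ∙ (u ∙ z)` stays in the same coset.
  unionOfCosets-∙-closed :
    {S : Pred Carrier s} (K : Subgroup G k) → IsDisjointUnionOfCosets G S K i →
    ∀ {x z} → x ∈ S → z ∈ Subgroup.member K → x ∙ z ∈ S
  unionOfCosets-∙-closed K S-cosets x∈S z∈K =
    let j , u , u∈K , tu≈x = proj₁ union x∈S in
    proj₂ union (j , u ∙ _ , Subgroup.∙-closed K u∈K z∈K ,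
                 trans (sym (assoc _ _ _)) (∙-congʳ tu≈x))
    where open IsDisjointUnionOfCosets S-cosets

corollary2p10 : ∀ {c ℓ a b s y r h i} (G : AbelianGroup c ℓ) →
    (A : FiniteSubset (AbelianGroup.setoid G) a) (B : FiniteSubset (AbelianGroup.setoid G) b) →
    Satisfiable (pred A) → Satisfiable (pred B) → ∣ A ∣ ≡ ∣ B ∣ →
    Unmatchable G (pred A) (pred B) →
    (S : Pred (AbelianGroup.Carrier G) s) (Y : FiniteSubset (AbelianGroup.setoid G) y) (R : FiniteSubset (AbelianGroup.setoid G) r) →
    pred A ≐ S ∪ pred Y → S ⊥ pred Y →
    Satisfiable (pred R) → pred R ⊆ pred B →
    IsDisjointUnionOfCosets G S (⟨_⟩ G (pred R)) i →
    ∣ Y ∣ < ∣ R ∣ →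
    (H : Subgroup G h) →
    Subgroup.member H ∩ (quotients G S ∪ quotients G (pred R)) ≐ ｛1｝ G →
    Unmatchable (quotientGroup G H) (project G H (pred A)) (project G H (pred B))
corollary2p10 G A B _ _ _ _ S Y R (A⊆S∪Y , S∪Y⊆A) _ _ R⊆B S-cosets ∣Y∣<∣R∣ H (H∩quotients⊆1 , _) M =
  <⇒≱ ∣Y∣<∣R∣ (injection⇒∣∣≤∣∣ R Y partner partner-injective)
  where
  open AbelianGroup G
  module G/H = AbelianGroup (quotientGroup G H)
  module π = IsGroupHomomorphism (quotientMap-isGroupHomomorphism G H)
  module M where
    open Matching M public
    open Bijection bijection public using (cong; strictlySurjective)

  -- A relation rather than a function of `r`, because the matching determines `x` only modulo `H`.
  Partner : Carrier → Carrier → Set _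
  Partner r x = ∃[ z ] proj₁ (M.to z) G/H.≈ r × x G/H.≈ proj₁ z

  partner-in-Y : ∀ {r} → r ∈ pred R → ∃[ x ] x ∈ pred Y × Partner r x
  -- A point of `π(B)` carries a lift to `B`; here `r` is its own lift.
  partner-in-Y {r} r∈R with M.strictlySurjective (r , r , R⊆B r∈R , G/H.refl)
  ... | z@(_ , x , x∈A , x∼z) , Mz∼r with A⊆S∪Y x∈A
  ... | inj₂ x∈Y = x , x∈Y , z , Mz∼r , x∼z
  -- `x ∙ r` is a lift to `A` of the product of `z` and its match, which `avoids` forbids.
  ... | inj₁ x∈S = ⊥-elim (M.avoids z (x ∙ r , S∪Y⊆A (inj₁ xr∈S) , G/H.∙-cong x∼z (G/H.sym Mz∼r)))
    where xr∈S = unionOfCosets-∙-closed G (⟨_⟩ G (pred R)) S-cosets x∈S (gen r∈R)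

  partner : Setoid.Carrier (elements setoid (pred R)) → Setoid.Carrier (elements setoid (pred Y))
  partner (_ , r∈R) = let x , x∈Y , _ = partner-in-Y r∈R in x , x∈Y

  -- The map `r ↦ x` runs against the matching, so its injectivity comes from the matching being
  -- well defined on classes: `x ≈ x′` forces `z` and `z′` into one class, hence also their images.
  Partner-injective : ∀ {r r′ x x′} → Partner r x → Partner r′ x′ → x ≈ x′ → r G/H.≈ r′
  Partner-injective (_ , Mz∼r , x∼z) (_ , Mz′∼r′ , x′∼z′) x≈x′ =
    G/H.trans (G/H.sym Mz∼r) (G/H.trans (M.cong z∼z′) Mz′∼r′)
    where
    z∼z′ = G/H.trans (G/H.sym x∼z)
             (G/H.trans (π.⟦⟧-cong x≈x′) x′∼z′)

  partner-injective : Injective (Setoid._≈_ (elements setoid (pred R)))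
                                (Setoid._≈_ (elements setoid (pred Y))) partner
  partner-injective {r , r∈R} {r′ , r′∈R} x≈x′ =
    -- By definition `r∼r′` says that `r ∙ r′ ⁻¹` lies in `H`; it is also a quotient of elements of
    -- `R`, hence trivial.
    x∙y⁻¹≈ε⇒x≈y r r′ (H∩quotients⊆1 (r∼r′ , inj₂ (r , r′ , r∈R , r′∈R , refl)))
    where
    open AbelianGroupProperties G
    r∼r′ = Partner-injective (proj₂ (proj₂ (partner-in-Y r∈R))) (proj₂ (proj₂ (partner-in-Y r′∈R))) x≈x′
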